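{- Let $\mathbb{P}^e$ be an extended multi-adjoint logic program (EMALP) on an extended multi-adjoint lattice with carrier $L$, and let $\mathbb{P}^{\tilde e}$ be the corresponding constraint-free EMALP of $\mathbb{P}^e$. If $M^{\tilde e}\colon\Pi_{\mathbb{P}^e}\cup\{p_\bot\}\to L$ is a stable model of $\mathbb{P}^{\tilde e}$, then $M^{\tilde e}(p_\bot)=\bot$.
   Context: Adjoint pair: given a partially ordered set $(P,\leq)$, a pair $(\&,\leftarrow)$ of binary operations on $P$ is an adjoint pair if $\&$ is order-preserving in both arguments; $\leftarrow$ is order-preserving in its first argument (the consequent) and order-reversing in its second argument (the antecedent), i.e. $z\leftarrow y$ is increasing in $z$ and decreasing in $y$; and $x\leq (z\leftarrow y)$ iff $(x\& y)\leq z$ for all $x,y,z\in P$. Multi-adjoint lattice: a tuple $(L,\preceq,\leftarrow_1,\&_1,\dots,\leftarrow_r,\&_r)$ where $(L,\preceq)$ is a bounded lattice with bottom $\bot$ and top $\top$, each $(\&_i,\leftarrow_i)$ is an adjoint pair in $(L,\preceq)$, and $\top\&_i\vartheta=\vartheta\&_i\top=\vartheta$ for all $\vartheta\in L$ and all $i$. Extended aggregator: a mapping $@^e\colon L^n\to L$ on a complete lattice $(L,\preceq)$ which is order-preserving in its first $m$ arguments and order-reversing in its last $n-m$ arguments; one writes $@^e[x_1,\dots,x_m;x_{m+1},\dots,x_n]$. An extended multi-adjoint lattice is a multi-adjoint lattice, with $(L,\preceq)$ complete, enriched with a finite family of extended aggregators $@^e_1,\dots,@^e_k$ (arities $n$ and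 numbers $m$ may depend on the aggregator). EMALP: an extended multi-adjoint logic program $\mathbb{P}^e$ on such a lattice is a finite set of weighted rules $\langle p\leftarrow_i @^e[p_1,\dots,p_m;p_{m+1},\dots,p_n];\vartheta\rangle$ and of constraints $\langle c\leftarrow_i @^e[p_1,\dots,p_m;p_{m+1},\dots,p_n];\top\rangle$, where $i\in\{1,\dots,r\}$, $@^e$ is one of the extended aggregators of the lattice, $\vartheta,c\in L$, and $p,p_1,\dots,p_n$ are propositional symbols with $p_1,\dots,p_n$ pairwise distinct. $\Pi_{\mathbb{P}^e}$ denotes the set of propositional symbols appearing in $\mathbb{P}^e$. It is constraint-free if it contains no constraints. Semantics: an interpretation is a mapping $I$ from the set of propositional symbols of the program to $L$, extended by $I(x)=x$ for $x\in L$. Interpretations are ordered pointwise: $I_1\sqsubseteq I_2$ iff $I_1(p)\preceq I_2(p)$ for all $p$. A rule or constraint $\langle l\leftarrow_i @^e[p_1,\dots,p_m;p_{m+1},\dots,p_n];\vartheta\rangle$ ($l$ a propositional symbol or an element of $L$) is satisfied by $I$ iff $\vartheta\preceq I(l)\leftarrow_i @^e[I(p_1),\dots,I(p_m);I(p_{m+1}),\dots,I(p_n)]$. A model is an interpretation satisfying all rules and constraints. The least model is a model $I$ with $I\sqsubseteq J$ for every model $J$. Reduct and stable models: given an interpretation $M$, the reduct of the program with respect to $M$ is obtained by replacing every rule or constraint $\langle l\leftarrow_i @^e[p_1,\dots,p_m;p_{m+1},\dots,p_n];\vartheta\rangle$ by $\langle l\leftarrow_i @^e_M[p_1,\dots,p_m];\vartheta\rangle$,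 where $@^e_M[\vartheta_1,\dots,\vartheta_m]=@^e[\vartheta_1,\dots,\vartheta_m;M(p_{m+1}),\dots,M(p_n)]$; satisfaction and (least) models of the reduct are defined in the same way, over interpretations with the same domain as $M$. $M$ is a stable model of the program if $M$ is the least model of its reduct with respect to $M$. Corresponding constraint-free EMALP: for $c\in L$ let $f_c\colon L\to L$ be given by $f_c(x)=\bot$ if $x\preceq c$ and $f_c(x)=\top$ otherwise. Let $\mathcal{C}_{\mathbb{P}^e}$ be the set of constraints of $\mathbb{P}^e$, $p_\bot\notin\Pi_{\mathbb{P}^e}$ a new propositional symbol, $\&$ any of the conjunctors $\&_1,\dots,\&_r$ of the lattice, and $\neg\colon L\to L$ any negation operator (an order-reversing mapping with $\neg\bot=\top$ and $\neg\top=\bot$). The corresponding constraint-free EMALP is $$\mathbb{P}^{\tilde e}=(\mathbb{P}^e\setminus\mathcal{C}_{\mathbb{P}^e})\cup\{\langle p_\bot\leftarrow_i f_\bot(\neg p_\bot)\,\&\,f_c(\mathcal{B});\top\rangle\mid\langle c\leftarrow_i\mathcal{B};\top\rangle\in\mathcal{C}_{\mathbb{P}^e}\}.$$ For $\mathcal{B}=@^e[p_1,\dots,p_m;p_{m+1},\dots,p_n]$, the body of the new rule is given by the extended aggregator $@^{\tilde e}[p_1,\dots,p_m;p_{m+1},\dots,p_n,p_\bot]=f_\bot(\neg p_\bot)\,\&\,f_c(@^e[p_1,\dots,p_m;p_{m+1},\dots,p_n])$, order-preserving in the first $m$ arguments and order-reversing in the last $n-m+1$; the lattice is enriched with these aggregators.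 Interpretations of $\mathbb{P}^{\tilde e}$ are mappings $\Pi_{\mathbb{P}^e}\cup\{p_\bot\}\to L$. -}

module Defs where

open import Algebra.Core using (Op₁; Op₂)
open import Algebra.Definitions using (Identity)
open import Data.Fin using (Fin; zero; splitAt; _↑ˡ_; _↑ʳ_)
open import Data.Fin.Properties using (splitAt⁻¹-↑ˡ; splitAt⁻¹-↑ʳ)
open import Data.List using (List; []; map; _++_)
open import Data.List.Membership.Propositional using (_∈_; mapWith∈)
open import Data.List.Membership.Propositional.Properties using (∈-++⁺ˡ; ∈-++⁺ʳ; ∈-map⁺)
open import Data.List.Relation.Unary.All using (All)
open import Data.List.Relation.Unary.Any using (Any)
open import Data.Maybe using (Maybe; just; nothing)
open import Data.Maybe.Properties using (just-injective)
open import Data.Nat using (ℕ; _+_)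
open import Data.Product using (∃-syntax; _×_; _,_; proj₁; proj₂)
open import Data.Sum using (_⊎_; inj₁; inj₂; [_,_]′)
open import Data.Vec.Functional as Vector using (Vector)
open import Data.Vec.Functional.Relation.Binary.Pointwise using (Pointwise)
open import Function using (_∘_; flip; _⇔_; Injective)
open import Level using (Level; _⊔_; suc)
open import Relation.Binary using (Poset; _Preserves_⟶_; _Preserves₂_⟶_⟶_)
open import Relation.Binary.Lattice using (BoundedLattice)
open import Relation.Binary.PropositionalEquality using (_≡_; refl; sym; trans; cong)
open import Relation.Nullary using (¬_; contradiction)
open import Relation.Unary using (Pred)

private
  variable
    c ℓ₁ ℓ₂ v : Level

------------------------------------------------------------------------
-- Lattices

record IsAdjointPair (P : Poset c ℓ₁ ℓ₂) (_&_ _←_ : Op₂ (Poset.Carrier P)) : Set (c ⊔ ℓ₂) where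
  open Poset P
  field
    &-mono  : _&_ Preserves₂ _≤_ ⟶ _≤_ ⟶ _≤_
    ←-mono  : _←_ Preserves₂ _≤_ ⟶ flip _≤_ ⟶ _≤_
    adjoint : ∀ x y z → x ≤ (z ← y) ⇔ (x & y) ≤ z

record MultiAdjointLattice c ℓ₁ ℓ₂ : Set (suc (c ⊔ ℓ₁ ⊔ ℓ₂)) where
  field
    boundedLattice : BoundedLattice c ℓ₁ ℓ₂

  open BoundedLattice boundedLattice public
    renaming (refl to ≤-refl; trans to ≤-trans; antisym to ≤-antisym)

  field
    r           : ℕ
    conj impl   : Fin r → Op₂ Carrier
    adjointPair : ∀ i → IsAdjointPair poset (conj i) (impl i)
    conj-⊤      : ∀ i → Identity _≈_ ⊤ (conj i)

module _ (P : Poset c ℓ₁ ℓ₂) where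
  open Poset P

  IsSupremum : ∀ {s} → Pred Carrier s → Carrier → Set _
  IsSupremum S x = (∀ y → S y → y ≤ x) × (∀ z → (∀ y → S y → y ≤ z) → x ≤ z)

  IsInfimum : ∀ {s} → Pred Carrier s → Carrier → Set _
  IsInfimum S x = (∀ y → S y → x ≤ y) × (∀ z → (∀ y → S y → z ≤ y) → z ≤ x)

  IsComplete : Set _
  IsComplete = (S : Pred Carrier (ℓ₁ ⊔ ℓ₂)) → ∃[ x ] IsSupremum S x × ∃[ y ] IsInfimum S y

  -- The positive and the negative arguments form two separate blocks, of
  -- lengths m and n - m in the notation @[x₁,…,xₘ;xₘ₊₁,…,xₙ].
  record ExtendedAggregator : Set (c ⊔ ℓ₂) where
    field
      posArity negArity : ℕ
      ⟦_⟧  : Vector Carrier posArity → Vector Carrier negArity → Carrier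
      mono : ⟦_⟧ Preserves₂ Pointwise _≤_ ⟶ flip (Pointwise _≤_) ⟶ _≤_

record ExtendedMultiAdjointLattice c ℓ₁ ℓ₂ : Set (suc (c ⊔ ℓ₁ ⊔ ℓ₂)) where
  field
    multiAdjointLattice : MultiAdjointLattice c ℓ₁ ℓ₂

  open MultiAdjointLattice multiAdjointLattice public

  field
    complete    : IsComplete poset
    aggregators : List (ExtendedAggregator poset)

record NegationOperator (L : BoundedLattice c ℓ₁ ℓ₂) : Set (c ⊔ ℓ₁ ⊔ ℓ₂) where
  open BoundedLattice L
  field
    neg      : Op₁ Carrier
    antitone : neg Preserves _≤_ ⟶ flip _≤_
    neg-⊥    : neg ⊥ ≈ ⊤
    neg-⊤    : neg ⊤ ≈ ⊥

------------------------------------------------------------------------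
-- Syntax

module _ (𝓛 : ExtendedMultiAdjointLattice c ℓ₁ ℓ₂) (V : Set v) where
  open ExtendedMultiAdjointLattice 𝓛

  -- The part ←ᵢ @[p₁,…,pₘ;pₘ₊₁,…,pₙ] common to rules and constraints.
  record Body : Set (c ⊔ ℓ₂ ⊔ v) where
    field
      arrow         : Fin r
      aggregator    : ExtendedAggregator poset
      is-aggregator : aggregator ∈ aggregators

    open ExtendedAggregator aggregator public

    field
      pos      : Vector V posArity
      neg      : Vector V negArity
      distinct : Injective _≡_ _≡_ [ pos , neg ]′

  record Rule : Set (c ⊔ ℓ₂ ⊔ v) where
    field
      head   : V
      body   : Body
      weight : Carrier

  record Constraint : Set (c ⊔ ℓ₂ ⊔ v) where
    field
      bound : Carrier
      body  : Body

  -- Lists stand for finite sets: only membership matters for the semantics.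
  record EMALP : Set (c ⊔ ℓ₂ ⊔ v) where
    field
      rules       : List Rule
      constraints : List Constraint

module _ {𝓛 : ExtendedMultiAdjointLattice c ℓ₁ ℓ₂} {V : Set v} where

  _occursInBody_ : V → Body 𝓛 V → Set v
  p occursInBody B = (∃[ k ] pos k ≡ p) ⊎ (∃[ k ] neg k ≡ p)
    where open Body B

  -- If p ∈Π P holds for every p : V, then V is exactly the set Π_P of symbols
  -- appearing in P, and V → Carrier is the type of interpretations of P.
  _∈Π_ : V → EMALP 𝓛 V → Set (c ⊔ ℓ₂ ⊔ v)
  p ∈Π P =
    Any (λ R → Rule.head R ≡ p ⊎ p occursInBody Rule.body R) (EMALP.rules P) ⊎
    Any (λ C → p occursInBody Constraint.body C) (EMALP.constraints P)

------------------------------------------------------------------------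
-- Semantics

module Semantics (𝓛 : MultiAdjointLattice c ℓ₁ ℓ₂) (V : Set v) where
  open MultiAdjointLattice 𝓛

  Interpretation : Set (c ⊔ v)
  Interpretation = V → Carrier

  _⊑_ : Interpretation → Interpretation → Set (ℓ₂ ⊔ v)
  I ⊑ J = ∀ p → I p ≤ J p

  -- ⟨ l ←ᵢ @[p₁,…,pₘ;pₘ₊₁,…,pₙ] ; ϑ ⟩ for an arbitrary aggregator @, so that
  -- programs and their reducts share one notion of satisfaction.
  record Clause : Set (c ⊔ ℓ₂ ⊔ v) where
    field
      head       : V ⊎ Carrier
      arrow      : Fin r
      aggregator : ExtendedAggregator poset

    open ExtendedAggregator aggregator public

    field
      pos    : Vector V posArity
      neg    : Vector V negArity
      weight : Carrier

  value : Interpretation → V ⊎ Carrier → Carrier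
  value I = [ I , (λ x → x) ]′

  _⊨_ : Interpretation → Clause → Set ℓ₂
  I ⊨ C = weight ≤ impl arrow (value I head) (⟦ I ∘ pos ⟧ (I ∘ neg))
    where open Clause C

  IsModel : List Clause → Interpretation → Set _
  IsModel Cs I = All (I ⊨_) Cs

  IsLeastModel : List Clause → Interpretation → Set _
  IsLeastModel Cs I = IsModel Cs I × (∀ J → IsModel Cs J → I ⊑ J)

  reductClause : Interpretation → Clause → Clause
  reductClause M C = record
    { head       = head
    ; arrow      = arrow
    ; aggregator = record
      { posArity = posArity
      ; negArity = 0
      ; ⟦_⟧      = λ xs _ → ⟦ xs ⟧ (M ∘ neg)
      ; mono     = λ xs≤ys _ → mono xs≤ys (λ _ → ≤-refl)
      }
    ; pos        = pos
    ; neg        = Vector.[]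
    ; weight     = weight
    }
    where open Clause C

  reduct : Interpretation → List Clause → List Clause
  reduct M = map (reductClause M)

module _ (𝓛 : ExtendedMultiAdjointLattice c ℓ₁ ℓ₂) (V : Set v) where
  open ExtendedMultiAdjointLattice 𝓛
  open Semantics multiAdjointLattice V

  clause : V ⊎ Carrier → Body 𝓛 V → Carrier → Clause
  clause l B ϑ = record
    { head = l ; arrow = arrow ; aggregator = aggregator ; pos = pos ; neg = neg ; weight = ϑ }
    where open Body B

  ruleClause : Rule 𝓛 V → Clause
  ruleClause R = clause (inj₁ head) body weight
    where open Rule R

  constraintClause : Constraint 𝓛 V → Clause
  constraintClause C = clause (inj₂ bound) body ⊤
    where open Constraint C

  clauses : EMALP 𝓛 V → List Clause
  clauses P = map ruleClause rules ++ map constraintClause constraints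
    where open EMALP P

module _ {𝓛 : ExtendedMultiAdjointLattice c ℓ₁ ℓ₂} {V : Set v} where
  open ExtendedMultiAdjointLattice 𝓛 using (multiAdjointLattice)
  open Semantics multiAdjointLattice V

  IsStableModel : EMALP 𝓛 V → Interpretation → Set _
  IsStableModel P M = IsLeastModel (reduct M (clauses 𝓛 V P)) M

------------------------------------------------------------------------
-- The threshold functions f_c

module Threshold (𝓛 : ExtendedMultiAdjointLattice c ℓ₁ ℓ₂) where
  open ExtendedMultiAdjointLattice 𝓛

  -- The function "⊥ if x ≤ a, and ⊤ otherwise". The order is not assumed to be
  -- decidable, so the case distinction is made by the supremum of
  -- { ⊤ ∣ x ≰ a }; threshold-≤ and threshold-≰ are the two cases.
  private
    ⊤-if-≰ : Carrier → Carrier → Pred Carrier (ℓ₁ ⊔ ℓ₂)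
    ⊤-if-≰ a x y = y ≈ ⊤ × ¬ (x ≤ a)

  threshold : Carrier → Op₁ Carrier
  threshold a x = proj₁ (complete (⊤-if-≰ a x))

  threshold-isSupremum : ∀ a x → IsSupremum poset (λ y → y ≈ ⊤ × ¬ (x ≤ a)) (threshold a x)
  threshold-isSupremum a x = proj₁ (proj₂ (complete (⊤-if-≰ a x)))

  threshold-≤ : ∀ {a x} → x ≤ a → threshold a x ≈ ⊥
  threshold-≤ {a} {x} x≤a = ≤-antisym
    (proj₂ (threshold-isSupremum a x) ⊥ (λ _ (_ , x≰a) → contradiction x≤a x≰a))
    (minimum _)

  threshold-≰ : ∀ {a x} → ¬ (x ≤ a) → threshold a x ≈ ⊤
  threshold-≰ {a} {x} x≰a = ≤-antisym
    (maximum _)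
    (proj₁ (threshold-isSupremum a x) ⊤ (Eq.refl , x≰a))

  threshold-mono : ∀ a → threshold a Preserves _≤_ ⟶ _≤_
  threshold-mono a {x} {y} x≤y = proj₂ (threshold-isSupremum a x) _
    λ z (z≈⊤ , x≰a) → proj₁ (threshold-isSupremum a y) z (z≈⊤ , x≰a ∘ ≤-trans x≤y)

------------------------------------------------------------------------
-- The corresponding constraint-free program

-- Maybe V is V ∪ {p⊥}, with p⊥ a symbol outside V.
pattern p⊥ = nothing

module ConstraintFree
  (𝓛 : ExtendedMultiAdjointLattice c ℓ₁ ℓ₂) {V : Set v} (P : EMALP 𝓛 V)
  (j : Fin (ExtendedMultiAdjointLattice.r 𝓛))
  (negation : NegationOperator (ExtendedMultiAdjointLattice.boundedLattice 𝓛))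
  where

  open ExtendedMultiAdjointLattice 𝓛
  open Threshold 𝓛
  open NegationOperator negation using (antitone) renaming (neg to ∼_)
  open EMALP P

  -- f_⊥(¬ y) & f_a(@[xs;ys]), where y is the last negative argument.
  constraintAggregator : Carrier → ExtendedAggregator poset → ExtendedAggregator poset
  constraintAggregator a agg = record
    { posArity = posArity
    ; negArity = negArity + 1
    ; ⟦_⟧      = λ xs ys → conj j
        (threshold ⊥ (∼ ys (negArity ↑ʳ zero)))
        (threshold a (⟦ xs ⟧ (Vector.take negArity ys)))
    ; mono     = λ xs≤xs′ ys′≤ys → IsAdjointPair.&-mono (adjointPair j)
        (threshold-mono ⊥ (antitone (ys′≤ys (negArity ↑ʳ zero))))
        (threshold-mono a (mono xs≤xs′ (λ k → ys′≤ys (k ↑ˡ 1))))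
    }
    where open ExtendedAggregator agg

  newAggregator : Constraint 𝓛 V → ExtendedAggregator poset
  newAggregator C = constraintAggregator bound (Body.aggregator body)
    where open Constraint C

  enriched : ExtendedMultiAdjointLattice c ℓ₁ ℓ₂
  enriched = record
    { multiAdjointLattice = multiAdjointLattice
    ; complete            = complete
    ; aggregators         = aggregators ++ map newAggregator constraints
    }

  oldBody : Body 𝓛 V → Body enriched (Maybe V)
  oldBody B = record
    { arrow         = arrow
    ; aggregator    = aggregator
    ; is-aggregator = ∈-++⁺ˡ is-aggregator
    ; pos           = just ∘ pos
    ; neg           = just ∘ neg
    ; distinct      = λ {s} {t} eq → distinct (just-injective (trans (sym (lift s)) (trans eq (lift t))))
    }
    where
    open Body B
    lift : ∀ s → [ just ∘ pos , just ∘ neg ]′ s ≡ just ([ pos , neg ]′ s)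
    lift (inj₁ _) = refl
    lift (inj₂ _) = refl

  oldRule : Rule 𝓛 V → Rule enriched (Maybe V)
  oldRule R = record { head = just head ; body = oldBody body ; weight = weight }
    where open Rule R

  newBody : ∀ {C} → C ∈ constraints → Body enriched (Maybe V)
  newBody {C} C∈ = record
    { arrow         = arrow
    ; aggregator    = newAggregator C
    ; is-aggregator = ∈-++⁺ʳ aggregators (∈-map⁺ newAggregator C∈)
    ; pos           = just ∘ pos
    ; neg           = neg⁺
    ; distinct      = λ {s} {t} → distinct⁺ s t
    }
    where
    open Body (Constraint.body C)

    neg⁺ : Vector (Maybe V) (negArity + 1)
    neg⁺ = (just ∘ neg) Vector.++ (p⊥ Vector.∷ Vector.[])

    distinct⁺ : ∀ s t → [ just ∘ pos , neg⁺ ]′ s ≡ [ just ∘ pos , neg⁺ ]′ t → s ≡ t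
    distinct⁺ (inj₁ k) (inj₁ l) eq with refl ← distinct {inj₁ k} {inj₁ l} (just-injective eq) = refl
    distinct⁺ (inj₁ k) (inj₂ l) eq with splitAt negArity l
    ... | inj₁ l′ with () ← distinct {inj₁ k} {inj₂ l′} (just-injective eq)
    distinct⁺ (inj₁ k) (inj₂ l) () | inj₂ zero
    distinct⁺ (inj₂ k) (inj₁ l) eq with splitAt negArity k
    ... | inj₁ k′ with () ← distinct {inj₂ k′} {inj₁ l} (just-injective eq)
    distinct⁺ (inj₂ k) (inj₁ l) () | inj₂ zero
    distinct⁺ (inj₂ k) (inj₂ l) eq with splitAt negArity k in k≡ | splitAt negArity l in l≡
    ... | inj₁ k′ | inj₁ l′ with refl ← distinct {inj₂ k′} {inj₂ l′} (just-injective eq) =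
      cong inj₂ (trans (sym (splitAt⁻¹-↑ˡ k≡)) (splitAt⁻¹-↑ˡ l≡))
    ... | inj₂ zero | inj₂ zero =
      cong inj₂ (trans (sym (splitAt⁻¹-↑ʳ k≡)) (splitAt⁻¹-↑ʳ l≡))
    distinct⁺ (inj₂ k) (inj₂ l) () | inj₁ _    | inj₂ zero
    distinct⁺ (inj₂ k) (inj₂ l) () | inj₂ zero | inj₁ _

  newRule : ∀ {C} → C ∈ constraints → Rule enriched (Maybe V)
  newRule C∈ = record { head = p⊥ ; body = newBody C∈ ; weight = ⊤ }

  constraintFree : EMALP enriched (Maybe V)
  constraintFree = record
    { rules       = map oldRule rules ++ mapWith∈ constraints newRule
    ; constraints = []
    }

-- Every body added for a constraint has the form f_⊥(¬ x) & f_a(b) with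
-- x = M p⊥, and M satisfies its rule, so the body is at most x. If both
-- thresholds were ⊤ then x would be ⊤, whence ¬ x = ⊥ and f_⊥(¬ x) = ⊥. So all
-- these bodies are ⊥, and resetting p⊥ to ⊥ keeps M a model of the reduct, as
-- p⊥ never occurs positively in a body. By leastness, M p⊥ = ⊥.
{-# OPTIONS --safe #-}
module Submission where

open import Level using (Level)
open import Data.Fin using (Fin; zero; _↑ʳ_)
open import Data.List using ([]; _++_; map)
open import Data.List.Membership.Propositional using (_∈_)
open import Data.List.Membership.Propositional.Properties using (∈-++⁻; ∈-map⁻)
open import Data.List.Relation.Unary.Any.Properties using (mapWith∈⁻)
open import Data.List.Relation.Unary.All using (All; []; lookup; tabulate)
open import Data.List.Relation.Unary.All.Properties using (map⁺; map⁻; ++⁺; ++⁻ˡ)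
open import Data.Maybe using (Maybe; just; maybe)
open import Data.Product using (_,_; proj₁; proj₂)
open import Data.Sum using (inj₁; inj₂)
open import Data.Vec.Functional as Vector using ()
open import Data.Vec.Functional.Properties using (lookup-++ʳ)
open import Function using (_∘_; Equivalence)
open import Relation.Binary.PropositionalEquality using (_≡_; refl; sym; cong)
open import Relation.Nullary using (¬_; contradiction)
open import Defs

module _ {c ℓ₁ ℓ₂} (𝓛 : ExtendedMultiAdjointLattice c ℓ₁ ℓ₂) where
  open ExtendedMultiAdjointLattice 𝓛
  open Threshold 𝓛

  -- The set behind `threshold a x` holds only copies of `⊤`, and only if `x ≰ a`.
  threshold-least : ∀ {a x z} → (¬ (x ≤ a) → ⊤ ≤ z) → threshold a x ≤ z
  threshold-least {a} {x} {z} ⊤≤z = proj₂ (threshold-isSupremum a x) z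
    λ _ (y≈⊤ , x≰a) → ≤-trans (reflexive y≈⊤) (⊤≤z x≰a)

  -- Adjointness at `⊤`, the left unit of `conj i`: satisfying a clause of weight `⊤` means that the
  -- body is below the head.
  ⊤≤impl⇒≤ : ∀ i {y z} → ⊤ ≤ impl i z y → y ≤ z
  ⊤≤impl⇒≤ i {y} {z} ⊤≤ = ≤-trans (reflexive (Eq.sym (proj₁ (conj-⊤ i) y)))
    (Equivalence.to (IsAdjointPair.adjoint (adjointPair i) ⊤ y z) ⊤≤)

  ≤⇒⊤≤impl : ∀ i {y z} → y ≤ z → ⊤ ≤ impl i z y
  ≤⇒⊤≤impl i {y} {z} y≤z = Equivalence.from (IsAdjointPair.adjoint (adjointPair i) ⊤ y z)
    (≤-trans (reflexive (proj₁ (conj-⊤ i) y)) y≤z)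

  module _ (j : Fin r) (negation : NegationOperator boundedLattice) where
    open NegationOperator negation using (antitone; neg-⊤) renaming (neg to ∼_)

    -- The order need not be decidable, so the two case distinctions are replaced by
    -- the universal properties of the thresholds, applied through the adjunction.
    constraint-body-≤⊥ : ∀ {a b x} →
      conj j (threshold ⊥ (∼ x)) (threshold a b) ≤ x →
      conj j (threshold ⊥ (∼ x)) (threshold a b) ≤ ⊥
    constraint-body-≤⊥ {a} {b} {x} body≤x =
      Equivalence.to (adjoint _ _ _)
        (threshold-least λ ∼x≰⊥ → ≤⇒⊤≤impl j
          (threshold-least λ b≰a → contradiction (∼x≤⊥ ∼x≰⊥ b≰a) ∼x≰⊥))
      where
      open IsAdjointPair (adjointPair j)

      ⊤≤x : ¬ (∼ x ≤ ⊥) → ¬ (b ≤ a) → ⊤ ≤ x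
      ⊤≤x ∼x≰⊥ b≰a = ≤-trans (reflexive (Eq.sym (proj₁ (conj-⊤ j) ⊤))) (≤-trans
        (&-mono (reflexive (Eq.sym (threshold-≰ ∼x≰⊥))) (reflexive (Eq.sym (threshold-≰ b≰a))))
        body≤x)

      ∼x≤⊥ : ¬ (∼ x ≤ ⊥) → ¬ (b ≤ a) → ∼ x ≤ ⊥
      ∼x≤⊥ ∼x≰⊥ b≰a = ≤-trans (antitone (⊤≤x ∼x≰⊥ b≰a)) (reflexive neg-⊤)

module _ {c ℓ₁ ℓ₂ v} (𝓛 : ExtendedMultiAdjointLattice c ℓ₁ ℓ₂) {Π : Set v} (P : EMALP 𝓛 Π)
  (j : Fin (ExtendedMultiAdjointLattice.r 𝓛))
  (negation : NegationOperator (ExtendedMultiAdjointLattice.boundedLattice 𝓛))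
  where
  open ExtendedMultiAdjointLattice 𝓛
  open ConstraintFree 𝓛 P j negation
  open EMALP P
  open Semantics multiAdjointLattice (Maybe Π)

  reset : Interpretation → Interpretation
  reset M = maybe (M ∘ just) ⊥

  module _ (M : Interpretation) where

    -- The reduct stays that of `M` even if `I` is `reset M`, so `p⊥` in the negative block of a new
    -- body still reads `M p⊥`.
    _⊨ᴹ_ : Interpretation → Rule enriched (Maybe Π) → Set ℓ₂
    I ⊨ᴹ R = I ⊨ reductClause M (ruleClause enriched (Maybe Π) R)

    newRule-reset : ∀ {C} (C∈ : C ∈ constraints) → M ⊨ᴹ newRule C∈ → reset M ⊨ᴹ newRule C∈
    newRule-reset {C} C∈ M⊨ = ≤⇒⊤≤impl 𝓛 arrow (constraint-body-≤⊥ 𝓛 j negation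
      (≤-trans (⊤≤impl⇒≤ 𝓛 arrow M⊨) (reflexive (Eq.reflexive (cong M (sym last≡p⊥))))))
      where
      open Body (Constraint.body C)

      -- This index goes through a stuck `splitAt`, so the equation is needed to match the `x`
      -- inside the body with the head value `M p⊥`.
      last≡p⊥ : Body.neg (newBody C∈) (negArity ↑ʳ zero) ≡ p⊥
      last≡p⊥ = lookup-++ʳ (just ∘ neg) (p⊥ Vector.∷ Vector.[]) zero

    rule-reset : ∀ {R} → R ∈ EMALP.rules constraintFree → M ⊨ᴹ R → reset M ⊨ᴹ R
    rule-reset R∈ with ∈-++⁻ (map oldRule rules) R∈
    -- All symbols of an old rule have the form `just q`, where `reset M` and `M` agree by
    -- computation.
    ... | inj₁ R∈old with _ , _ , refl ← ∈-map⁻ oldRule R∈old = λ M⊨ → M⊨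
    ... | inj₂ R∈new with _ , C∈ , refl ← mapWith∈⁻ constraints newRule R∈new = newRule-reset C∈

    -- The final `++ []` is the empty list of constraint clauses of `constraintFree`.
    reset-isModel : ∀ {Rs} → (∀ {R} → R ∈ Rs → M ⊨ᴹ R → reset M ⊨ᴹ R) →
      let Cs = reduct M (map (ruleClause enriched (Maybe Π)) Rs ++ []) in
      IsModel Cs M → IsModel Cs (reset M)
    reset-isModel {Rs} preserves M-model =
      map⁺ (++⁺ (map⁺ (tabulate λ R∈ → preserves R∈ (lookup M⊨Rs R∈))) [])
      where
      M⊨Rs : All (M ⊨ᴹ_) Rs
      M⊨Rs = map⁻ (++⁻ˡ _ (map⁻ M-model))

theorem19 : ∀ {c ℓ₁ ℓ₂ v : Level} (𝓛 : ExtendedMultiAdjointLattice c ℓ₁ ℓ₂) →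
    let open ExtendedMultiAdjointLattice 𝓛 in
    {Π : Set v} (P : EMALP 𝓛 Π) → (∀ p → p ∈Π P) →
    (j : Fin r) (negation : NegationOperator boundedLattice) →
    let open ConstraintFree 𝓛 P j negation in
    (M : Maybe Π → Carrier) → IsStableModel constraintFree M →
    M p⊥ ≈ ⊥
theorem19 𝓛 P _ j negation M (M-model , M-least) = ≤-antisym
  (M-least (reset 𝓛 P j negation M)
    (reset-isModel 𝓛 P j negation M (rule-reset 𝓛 P j negation M) M-model) p⊥)
  (minimum (M p⊥))
  where open ExtendedMultiAdjointLattice 𝓛
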